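{- Let $k\ge 3$, $n\ge1$, and suppose $[a_0,\dots,a_{k-1}]$ is an algebraic $k$-gon modulo $n$ with $0<a_i<2n$ and $a_i\ne n$ for all $i$, and $a_0+\dots+a_{k-1}\le(k-2)n$. Then there exists an associate $[b_0,\dots,b_{k-1}]$ of $[a_0,\dots,a_{k-1}]$ that is a (geometric) $k$-gon modulo $n$. Consequently, there exists a polygon in the plane with consecutive angles $\frac{b_0}{n}\pi,\dots,\frac{b_{k-1}}{n}\pi$ and no self-crossings.
   Context: An algebraic $k$-gon modulo $n$ is a $k$-tuple of nonnegative integers with $\sum a_i\equiv0\pmod n$ and $\gcd(a_0,\dots,a_{k-1},n)=1$. A (geometric) $k$-gon modulo $n$ is a $k$-tuple of positive integers with $\sum a_i=(k-2)n$, $a_i<2n$, $a_i\ne n$, and $\gcd(a_0,\dots,a_{k-1},n)=1$. Two algebraic $k$-gons $[a_i]$, $[b_i]$ modulo $n$ are associates if there is $c\in(\mathbb{Z}/n\mathbb{Z})^\times$ with $b_i\equiv ca_i\pmod n$ for all $i$. -}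

module Defs where

open import Data.Nat using (ℕ; suc; _+_; _*_; _∸_; _≤_; _<_)
open import Data.Nat.GCD using (gcd)
open import Data.Nat.Coprimality using (Coprime)
open import Data.Vec using (Vec; lookup; sum; foldr′)
open import Data.Fin using (Fin)
open import Data.Product using (_×_; Σ)
open import Data.Integer as ℤ using (ℤ; +_)
open import Data.Integer.Divisibility as ℤd using ()
open import Relation.Binary.PropositionalEquality using (_≡_; _≢_)

_≡_[mod_] : ℕ → ℕ → ℕ → Set
a ≡ b [mod n ] = (+ n) ℤd.∣ ((+ b) ℤ.- (+ a))

gcdWith : ∀ {k} → Vec ℕ k → ℕ → ℕ
gcdWith a n = foldr′ gcd n a

AlgebraicGon : (k n : ℕ) → Vec ℕ k → Set
AlgebraicGon k n a = (sum a ≡ 0 [mod n ]) × gcdWith a n ≡ 1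

Gon : (k n : ℕ) → Vec ℕ k → Set
Gon k n a =
  ((i : Fin k) → 0 < lookup a i) ×
  (sum a ≡ (k ∸ 2) * n) ×
  ((i : Fin k) → lookup a i < 2 * n) ×
  ((i : Fin k) → lookup a i ≢ n) ×
  gcdWith a n ≡ 1

-- [b_i] is an associate of [a_i] modulo n: there is a unit c of ℤ/nℤ
-- (represented by a natural number coprime to n) with b_i ≡ c a_i (mod n)
Associate : (k n : ℕ) → Vec ℕ k → Vec ℕ k → Set
Associate k n a b =
  Σ ℕ (λ c → Coprime c n × ((i : Fin k) → lookup b i ≡ c * lookup a i [mod n ]))

{-# OPTIONS --safe #-}
-- Reduce every aᵢ to its residue rᵢ = aᵢ % n.  Since aᵢ ∉ {0, n} and aᵢ < 2n, n does not
-- divide aᵢ, so 0 < rᵢ < n.  The residues sum to a multiple s·n of n with s ≤ k − 2,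
-- because rᵢ ≤ aᵢ and Σ aᵢ ≤ (k − 2)n.  Adding n to k − 2 − s of the residues gives entries
-- in (0, 2n) ∖ {n} summing to exactly (k − 2)n, each congruent to aᵢ modulo n; so it is the
-- associate of a for c = 1, and it has the same gcd with n as a.
module Submission where

open import Defs
open import Data.Nat using (ℕ; _+_; _*_; _∸_; _≤_; _<_)
open import Data.Vec using (Vec; lookup; sum)
open import Data.Fin using (Fin)
open import Data.Product using (Σ; _×_)
open import Relation.Binary.PropositionalEquality using (_≢_)

open import Data.Nat using (zero; suc; z≤n; s≤s; NonZero; >-nonZero)
open import Data.Nat.Properties
open import Data.Nat.DivMod
open import Algebra.Properties.CommutativeSemigroup +-commutativeSemigroup
  using () renaming (interchange to +-interchange)
open import Data.Nat.Divisibility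
  using (_∣_; divides; ∣-refl; ∣-trans; ∣-antisym; ∣m∣n⇒∣m+n; ∣m+n∣m⇒∣n; ∣n⇒∣m*n;
         m%n≡0⇒n∣m; n∣m⇒m%n≡0)
open import Data.Nat.GCD using (gcd[m,n]∣m; gcd[m,n]∣n; gcd-greatest)
open import Data.Nat.Coprimality using (1-coprimeTo)
open import Data.Vec using ([]; _∷_; map)
open import Data.Vec.Properties using (lookup-map)
open import Data.Fin using () renaming (zero to fzero; suc to fsuc)
open import Data.Product using (_,_; proj₁; proj₂)
open import Data.Sum using (_⊎_; inj₁; inj₂)
open import Relation.Nullary using (¬_)
open import Relation.Binary.PropositionalEquality
  using (_≡_; refl; sym; trans; cong; cong₂; subst; module ≡-Reasoning)
import Data.Integer as ℤ
import Data.Integer.Properties as ℤₚ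
import Data.Integer.Divisibility.Signed as ℤˢ
open import Data.Integer.Solver using (module +-*-Solver)

open ≡-Reasoning

private
  variable
    k n : ℕ

%≡%⇒≡[mod] : ∀ {x y} .{{_ : NonZero n}} → x % n ≡ y % n → x ≡ y [mod n ]
%≡%⇒≡[mod] {n} {x} {y} x%n≡y%n = ℤˢ.∣⇒∣ᵤ (ℤˢ.divides (ℤ.+ (y / n) ℤ.- ℤ.+ (x / n)) +y-+x≡)
  where
  open ℤ using (+_)
  open +-*-Solver using (solve; _:=_; _:+_; _:-_; _:*_)

  +-divMod : ∀ m → + m ≡ + (m % n) ℤ.+ + (m / n) ℤ.* + n
  +-divMod m = begin
    + m                                  ≡⟨ cong +_ (m≡m%n+[m/n]*n m n) ⟩
    + (m % n + m / n * n)                ≡⟨ ℤₚ.pos-+ (m % n) (m / n * n) ⟩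
    + (m % n) ℤ.+ + (m / n * n)          ≡⟨ cong (ℤ._+_ (+ (m % n))) (ℤₚ.pos-* (m / n) n) ⟩
    + (m % n) ℤ.+ + (m / n) ℤ.* + n      ∎

  +y-+x≡ : + y ℤ.- + x ≡ (+ (y / n) ℤ.- + (x / n)) ℤ.* + n
  +y-+x≡ = begin
    + y ℤ.- + x
      ≡⟨ cong₂ ℤ._-_ (+-divMod y)
                     (trans (+-divMod x) (cong (λ r → + r ℤ.+ + (x / n) ℤ.* + n) x%n≡y%n)) ⟩
    (+ (y % n) ℤ.+ + (y / n) ℤ.* + n) ℤ.- (+ (y % n) ℤ.+ + (x / n) ℤ.* + n)
      ≡⟨ solve 4 (λ r q p m → (r :+ q :* m) :- (r :+ p :* m) := (q :- p) :* m) refl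
           (+ (y % n)) (+ (y / n)) (+ (x / n)) (+ n) ⟩
    (+ (y / n) ℤ.- + (x / n)) ℤ.* + n    ∎

≡0[mod]⇒∣ : ∀ {x} → x ≡ 0 [mod n ] → n ∣ x
≡0[mod]⇒∣ {n} {x} n∣-x =
  subst (n ∣_) (ℤₚ.∣-i∣≡∣i∣ (ℤ.+ x)) (subst (λ i → n ∣ ℤ.∣ i ∣) (ℤₚ.+-identityˡ (ℤ.- ℤ.+ x)) n∣-x)

∣-%-cong : ∀ {d x y} .{{_ : NonZero n}} → d ∣ n → x % n ≡ y % n → d ∣ x → d ∣ y
∣-%-cong {n} {d} {x} {y} d∣n x%n≡y%n d∣x =
  subst (d ∣_) (sym (m≡m%n+[m/n]*n y n)) (∣m∣n⇒∣m+n d∣y%n (∣n⇒∣m*n (y / n) d∣n))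
  where
  d∣y%n : d ∣ y % n
  d∣y%n = subst (d ∣_) x%n≡y%n
    (∣m+n∣m⇒∣n (subst (d ∣_) (trans (m≡m%n+[m/n]*n x n) (+-comm (x % n) _)) d∣x)
               (∣n⇒∣m*n (x / n) d∣n))

gcdWith∣n : (v : Vec ℕ k) → gcdWith v n ∣ n
gcdWith∣n []      = ∣-refl
gcdWith∣n (x ∷ v) = ∣-trans (gcd[m,n]∣n x _) (gcdWith∣n v)

gcdWith∣lookup : (v : Vec ℕ k) (i : Fin k) → gcdWith v n ∣ lookup v i
gcdWith∣lookup (x ∷ v) fzero    = gcd[m,n]∣m x _
gcdWith∣lookup (x ∷ v) (fsuc i) = ∣-trans (gcd[m,n]∣n x _) (gcdWith∣lookup v i)

gcdWith-greatest : ∀ {d} (v : Vec ℕ k) → d ∣ n → (∀ i → d ∣ lookup v i) → d ∣ gcdWith v n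
gcdWith-greatest []      d∣n d∣v = d∣n
gcdWith-greatest (x ∷ v) d∣n d∣v =
  gcd-greatest (d∣v fzero) (gcdWith-greatest v d∣n (λ i → d∣v (fsuc i)))

gcdWith∣gcdWith : .{{_ : NonZero n}} (u v : Vec ℕ k) →
  (∀ i → lookup u i % n ≡ lookup v i % n) → gcdWith u n ∣ gcdWith v n
gcdWith∣gcdWith u v u≡v = gcdWith-greatest v (gcdWith∣n u)
  (λ i → ∣-%-cong (gcdWith∣n u) (u≡v i) (gcdWith∣lookup u i))

gcdWith-cong-% : .{{_ : NonZero n}} (u v : Vec ℕ k) →
  (∀ i → lookup u i % n ≡ lookup v i % n) → gcdWith u n ≡ gcdWith v n
gcdWith-cong-% u v u≡v =
  ∣-antisym (gcdWith∣gcdWith u v u≡v) (gcdWith∣gcdWith v u (λ i → sym (u≡v i)))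

sum-map-%≤sum : .{{_ : NonZero n}} (v : Vec ℕ k) → sum (map (_% n) v) ≤ sum v
sum-map-%≤sum         []      = z≤n
sum-map-%≤sum {n = n} (x ∷ v) = +-mono-≤ (m%n≤m x n) (sum-map-%≤sum v)

sum-map-%-% : .{{_ : NonZero n}} (v : Vec ℕ k) → sum (map (_% n) v) % n ≡ sum v % n
sum-map-%-%         []      = refl
sum-map-%-% {n = n} (x ∷ v) = begin
  (x % n + sum (map (_% n) v)) % n          ≡⟨ %-distribˡ-+ (x % n) _ n ⟩
  (x % n % n + sum (map (_% n) v) % n) % n  ≡⟨ cong₂ (λ p q → (p + q) % n)
                                                  (m%n%n≡m%n x n) (sum-map-%-% v) ⟩
  (x % n + sum v % n) % n                   ≡⟨ %-distribˡ-+ x (sum v) n ⟨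
  (x + sum v) % n                           ∎

raiseFirst : ℕ → ℕ → Vec ℕ k → Vec ℕ k
raiseFirst n zero    v       = v
raiseFirst n (suc t) []      = []
raiseFirst n (suc t) (x ∷ v) = x + n ∷ raiseFirst n t v

lookup-raiseFirst : ∀ t (v : Vec ℕ k) (i : Fin k) →
  lookup (raiseFirst n t v) i ≡ lookup v i ⊎ lookup (raiseFirst n t v) i ≡ lookup v i + n
lookup-raiseFirst zero    v       i        = inj₁ refl
lookup-raiseFirst (suc t) (x ∷ v) fzero    = inj₂ refl
lookup-raiseFirst (suc t) (x ∷ v) (fsuc i) = lookup-raiseFirst t v i

lookup-raiseFirst-% : .{{_ : NonZero n}} → ∀ t (v : Vec ℕ k) (i : Fin k) →
  lookup (raiseFirst n t v) i % n ≡ lookup v i % n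
lookup-raiseFirst-% {n} t v i with lookup-raiseFirst {n = n} t v i
... | inj₁ eq = cong (_% n) eq
... | inj₂ eq = trans (cong (_% n) eq) ([m+n]%n≡m%n (lookup v i) n)

sum-raiseFirst : ∀ t (v : Vec ℕ k) → t ≤ k → sum (raiseFirst n t v) ≡ sum v + t * n
sum-raiseFirst         zero    v       _         = sym (+-identityʳ (sum v))
sum-raiseFirst {n = n} (suc t) (x ∷ v) (s≤s t≤k) = begin
  x + n + sum (raiseFirst n t v)  ≡⟨ cong (x + n +_) (sum-raiseFirst t v t≤k) ⟩
  x + n + (sum v + t * n)         ≡⟨ +-interchange x n (sum v) (t * n) ⟩
  x + sum v + suc t * n           ∎

sum-raiseFirst-∸ : ∀ m s (v : Vec ℕ k) → m ≤ k → s ≤ m → sum v ≡ s * n →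
  sum (raiseFirst n (m ∸ s) v) ≡ m * n
sum-raiseFirst-∸ {n = n} m s v m≤k s≤m Σv≡s*n = begin
  sum (raiseFirst n (m ∸ s) v)  ≡⟨ sum-raiseFirst (m ∸ s) v (≤-trans (m∸n≤m m s) m≤k) ⟩
  sum v + (m ∸ s) * n           ≡⟨ cong (_+ (m ∸ s) * n) Σv≡s*n ⟩
  s * n + (m ∸ s) * n           ≡⟨ *-distribʳ-+ n s (m ∸ s) ⟨
  (s + (m ∸ s)) * n             ≡⟨ cong (_* n) (m+[n∸m]≡n s≤m) ⟩
  m * n                         ∎

-- x stands for the interior angle xπ/n: positive, below 2π, and not a straight angle.
ProperAngle : ℕ → ℕ → Set
ProperAngle n x = 0 < x × x < 2 * n × x ≢ n

ProperAngle⇒∤ : ∀ {x} → ProperAngle n x → ¬ n ∣ x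
ProperAngle⇒∤ (0<x , _ , _) (divides zero          refl) = <-irrefl refl 0<x
ProperAngle⇒∤ (_ , _ , x≢n) (divides (suc zero)    refl) = x≢n (*-identityˡ _)
ProperAngle⇒∤ {n} (_ , x<2n , _) (divides (suc (suc q)) refl) =
  <-irrefl refl (<-≤-trans x<2n (*-monoˡ-≤ n {2} {suc (suc q)} (s≤s (s≤s z≤n))))

ProperAngle⇒0<% : .{{_ : NonZero n}} → ∀ {x} → ProperAngle n x → 0 < x % n
ProperAngle⇒0<% {n} {x} px = n≢0⇒n>0 (λ x%n≡0 → ProperAngle⇒∤ px (m%n≡0⇒n∣m x n x%n≡0))

module _ {r : ℕ} (0<r : 0 < r) (r<n : r < n) where

  ProperAngle-residue : ProperAngle n r
  ProperAngle-residue = 0<r , <-≤-trans r<n (m≤n*m n 2) , <⇒≢ r<n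

  ProperAngle-residue+n : ProperAngle n (r + n)
  ProperAngle-residue+n =
    <-≤-trans 0<r (m≤m+n r n) ,
    subst (r + n <_) (cong (n +_) (sym (+-identityʳ n))) (+-monoˡ-< n r<n) ,
    >⇒≢ (+-monoˡ-< n 0<r)

ProperAngle-raiseFirst : ∀ t (v : Vec ℕ k) → (∀ i → 0 < lookup v i × lookup v i < n) →
  ∀ i → ProperAngle n (lookup (raiseFirst n t v) i)
ProperAngle-raiseFirst {n = n} t v 0<v<n i with 0<v<n i | lookup-raiseFirst {n = n} t v i
... | 0<vᵢ , vᵢ<n | inj₁ eq = subst (ProperAngle n) (sym eq) (ProperAngle-residue 0<vᵢ vᵢ<n)
... | 0<vᵢ , vᵢ<n | inj₂ eq = subst (ProperAngle n) (sym eq) (ProperAngle-residue+n 0<vᵢ vᵢ<n)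

properRepresentatives : ∀ m .{{_ : NonZero n}} (a : Vec ℕ k) →
  m ≤ k → n ∣ sum a → sum a ≤ m * n → (∀ i → ProperAngle n (lookup a i)) →
  Σ (Vec ℕ k) λ b → sum b ≡ m * n × (∀ i → lookup b i % n ≡ lookup a i % n) ×
                    (∀ i → ProperAngle n (lookup b i))
properRepresentatives {n = n} m a m≤k n∣Σa Σa≤m*n proper =
  raiseFirst n (m ∸ s) r ,
  sum-raiseFirst-∸ m s r m≤k s≤m Σr≡s*n ,
  (λ i → trans (lookup-raiseFirst-% (m ∸ s) r i)
               (trans (cong (_% n) (rᵢ≡ i)) (m%n%n≡m%n (lookup a i) n))) ,
  ProperAngle-raiseFirst (m ∸ s) r (λ i →
    subst (0 <_) (sym (rᵢ≡ i)) (ProperAngle⇒0<% (proper i)) ,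
    subst (_< n) (sym (rᵢ≡ i)) (m%n<n (lookup a i) n))
  where
  r = map (_% n) a
  s = sum r / n

  rᵢ≡ : ∀ i → lookup r i ≡ lookup a i % n
  rᵢ≡ i = lookup-map i (_% n) a

  Σr≡s*n : sum r ≡ s * n
  Σr≡s*n = sym (m/n*n≡m (m%n≡0⇒n∣m (sum r) n
    (trans (sum-map-%-% a) (n∣m⇒m%n≡0 (sum a) n n∣Σa))))

  s≤m : s ≤ m
  s≤m = *-cancelʳ-≤ s m n (≤-trans (≤-reflexive (sym Σr≡s*n)) (≤-trans (sum-map-%≤sum a) Σa≤m*n))

proposition2 : (k n : ℕ) → 3 ≤ k → 1 ≤ n → (a : Vec ℕ k) →
    AlgebraicGon k n a →
    ((i : Fin k) → 0 < lookup a i) →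
    ((i : Fin k) → lookup a i < 2 * n) →
    ((i : Fin k) → lookup a i ≢ n) →
    sum a ≤ (k ∸ 2) * n →
    Σ (Vec ℕ k) (λ b → Associate k n a b × Gon k n b)
proposition2 k n _ 1≤n a (Σa≡0 , gcd≡1) pos lt ne Σa≤ =
  let b , Σb≡ , b%≡a% , proper = properRepresentatives (k ∸ 2) a (m∸n≤m k 2)
                                   (≡0[mod]⇒∣ Σa≡0) Σa≤ (λ i → pos i , lt i , ne i)
  in b ,
     (1 , 1-coprimeTo n , λ i → subst (λ x → lookup b i ≡ x [mod n ])
                                      (sym (*-identityˡ (lookup a i))) (%≡%⇒≡[mod] (b%≡a% i))) ,
     (λ i → proj₁ (proper i)) , Σb≡ , (λ i → proj₁ (proj₂ (proper i))) ,
     (λ i → proj₂ (proj₂ (proper i))) , trans (gcdWith-cong-% b a b%≡a%) gcd≡1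
  where
  instance
    n≢0 : NonZero n
    n≢0 = >-nonZero 1≤n
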